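{- Let $A\in\mathcal{PM}(n)$. A row vector $v\in\{0,1\}^n$ is a poset vector of $A$ if and only if $vA=v$, where the product is the Boolean matrix product. Equivalently, the set of order ideals of $P_A$ equals $\{\mathrm{supp}(v): v\in\{0,1\}^n,\ vA=v\}$.
   Context: Let $X_n=\{0,1,\ldots,n-1\}$. A naturally labeled (NL) poset on $X_n$ is a partial order $\preceq$ on $X_n$ such that $x\preceq y$ implies $x\le y$ in the usual integer order. Its poset matrix is the $n\times n$ $(0,1)$-matrix $A=(a_{i,j})_{i,j\in X_n}$ with $a_{i,j}=1$ if $j\preceq i$ and $0$ otherwise; $\mathcal{PM}(n)$ is the set of all such matrices and $P_A$ the NL poset with poset matrix $A$. Boolean arithmetic: $1+1=1$, so $(vA)_j=\max_i v_ia_{i,j}$. For $v\in\{0,1\}^n$, $A^v=\begin{bmatrix}A&\mathbf{0}\\ v&1\end{bmatrix}$, and $v$ is a poset vector of $A$ if $A^v\in\mathcal{PM}(n+1)$. $\mathrm{supp}(v)=\{j: v_j=1\}$; an order ideal is a downward closed subset. -}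

module Defs where

open import Algebra.Bundles using (CommutativeSemiring)
open import Data.Bool using (Bool; true; false; _∧_)
import Data.Bool as Bool
open import Data.Bool.Properties using (∨-∧-commutativeSemiring)
open import Data.Fin using (Fin)
import Data.Fin as Fin
open import Data.Fin.Subset using (Subset; _∈_)
open import Data.Nat using (ℕ; suc)
open import Data.Product using (Σ; Σ-syntax; _×_)
open import Data.Vec using (Vec; lookup; tabulate; map; _∷ʳ_)
open import Level using (0ℓ)
open import Relation.Binary using (Rel; IsDecPartialOrder)
open import Relation.Binary.PropositionalEquality using (_≡_)
open import Relation.Nullary using (does)
open import Relation.Unary using (Pred)

-- Summation in the Boolean semiring, where addition is _∨_ (so 1 + 1 = 1).
open import Algebra.Properties.Semiring.Sum (CommutativeSemiring.semiring ∨-∧-commutativeSemiring) using (sum-syntax)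

private
  variable
    n : ℕ

-- The bits 0 and 1 are false and true; Fin n is X_n = {0, …, n-1}.

RowVector : ℕ → Set
RowVector n = Vec Bool n

-- A vector of rows.
Matrix : ℕ → Set
Matrix n = Vec (RowVector n) n

entry : Matrix n → Fin n → Fin n → Bool
entry A i j = lookup (lookup A i) j

-- Decidability is automatic classically; it is what makes the
-- (0,1)-matrix of the order definable.
record NLPoset (n : ℕ) : Set₁ where
  infix 4 _≼_
  field
    _≼_               : Rel (Fin n) 0ℓ
    isDecPartialOrder : IsDecPartialOrder _≡_ _≼_
    naturallyLabeled  : ∀ {x y} → x ≼ y → x Fin.≤ y

  open IsDecPartialOrder isDecPartialOrder public
    renaming (_≤?_ to _≼?_)

-- The (i , j) entry is 1 iff j ≼ i, so the matrix is lower triangular.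
posetMatrix : NLPoset n → Matrix n
posetMatrix P = tabulate λ i → tabulate λ j → does (j ≼? i)
  where open NLPoset P

PM : (n : ℕ) → Pred (Matrix n) _
PM n A = Σ[ P ∈ NLPoset n ] posetMatrix P ≡ A

-- P_A. As an order relation it is determined by A up to logical equivalence.
posetOf : {A : Matrix n} → PM n A → NLPoset n
posetOf = Σ.proj₁

infixl 7 _·_

_·_ : RowVector n → Matrix n → RowVector n
_·_ {n} v A = tabulate λ j → ∑[ i < n ] (lookup v i ∧ entry A i j)

-- The block matrix A^v: each row of A gets a final 0, and (v , 1) is
-- the new last row.
_^^_ : Matrix n → RowVector n → Matrix (suc n)
A ^^ v = map (_∷ʳ false) A ∷ʳ (v ∷ʳ true)

IsPosetVector : Matrix n → RowVector n → Set₁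
IsPosetVector {n} A v = PM (suc n) (A ^^ v)

supp : RowVector n → Subset n
supp v = tabulate λ j → does (lookup v j Bool.≟ true)

OrderIdeals : NLPoset n → Pred (Subset n) 0ℓ
OrderIdeals P S = ∀ {x y} → y ∈ S → x ≼ y → x ∈ S
  where open NLPoset P

FixedSupports : Matrix n → Pred (Subset n) 0ℓ
FixedSupports {n} A S = Σ[ v ∈ RowVector n ] (v · A ≡ v × supp v ≡ S)

{-# OPTIONS --safe #-}

-- Reading 1-entries as relations, both "v is a poset vector of A" and "vA = v"
-- say that supp v is closed downwards in P_A. For the former, the new top
-- element of A^v lies above exactly supp v, so the only new instances of
-- transitivity are those passing through the last row. For the latter, vA ≤ v
-- is downward closure, while v ≤ vA is automatic from the 1s on the diagonal.
module Submission where

open import Defs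
open import Algebra.Bundles using (CommutativeSemiring)
open import Data.Bool using (Bool; true; false; _∧_)
import Data.Bool as Bool
open import Data.Bool.Properties using (∨-∧-commutativeSemiring; ∨-zeroʳ; ∧-conicalˡ; ∧-conicalʳ; ⇔→≡)
open import Data.Fin using (Fin; zero; suc; fromℕ; inject₁)
import Data.Fin as Fin
open import Data.Fin.Properties using (≤-antisym; ≤fromℕ; toℕ-inject₁)
open import Data.Fin.Relation.Unary.Top using (view; ‵fromℕ; ‵inject₁)
open import Data.Nat using (ℕ; suc)
import Data.Nat as ℕ
open import Data.Product using (∃-syntax; _×_; _,_)
open import Data.Vec using (Vec; _∷_; []; lookup; map; _∷ʳ_)
open import Data.Vec.Properties using ([]=⇒lookup; lookup⇒[]=; lookup∘tabulate; lookup-map; tabulate∘lookup; tabulate-cong)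
open import Function.Base using (_∘_)
open import Function.Bundles using (_⇔_; mk⇔; Equivalence)
open import Function.Construct.Composition using (_⇔-∘_)
open import Function.Construct.Symmetry using (⇔-sym)
open import Relation.Binary.PropositionalEquality using (_≡_; refl; sym; trans; cong; cong₂; subst; subst₂; isEquivalence)
open import Relation.Nullary using (Dec; does; yes; contradiction)
open import Relation.Nullary.Decidable using (dec-true)
open import Relation.Unary using (_≐_)

open import Algebra.Properties.Semiring.Sum (CommutativeSemiring.semiring ∨-∧-commutativeSemiring) using (sum)

open Equivalence using (to; from)

private
  variable
    n : ℕ

does-true⇔ : ∀ {p} {P : Set p} (P? : Dec P) → does P? ≡ true ⇔ P
does-true⇔ P? = mk⇔ (witness P?) (dec-true P?)
  where
  witness : ∀ {p} {P : Set p} (P? : Dec P) → does P? ≡ true → P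
  witness (yes p) _ = p

does-≟true : ∀ b → does (b Bool.≟ true) ≡ b
does-≟true false = refl
does-≟true true  = refl

-- Boolean addition is disjunction, so a finite sum acts as an existential quantifier. This is how
-- the entries of `v · A` are read below.
sum-true⇔ : (f : Fin n → Bool) → sum f ≡ true ⇔ (∃[ i ] f i ≡ true)
sum-true⇔ f = mk⇔ (split f) (λ (i , fi) → single f i fi)
  where
  split : ∀ {n} (f : Fin n → Bool) → sum f ≡ true → ∃[ i ] f i ≡ true
  split {suc n} f eq with f zero in f0
  ... | true  = zero , f0
  ... | false = let i , fi = split (f ∘ suc) eq in suc i , fi

  single : ∀ {n} (f : Fin n → Bool) i → f i ≡ true → sum f ≡ true
  single f zero    fi rewrite fi = refl
  single f (suc i) fi rewrite single (f ∘ suc) i fi = ∨-zeroʳ (f zero)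

lookup-∷ʳ-fromℕ : ∀ {a} {A : Set a} (xs : Vec A n) (x : A) → lookup (xs ∷ʳ x) (fromℕ n) ≡ x
lookup-∷ʳ-fromℕ []       x = refl
lookup-∷ʳ-fromℕ (_ ∷ xs) x = lookup-∷ʳ-fromℕ xs x

lookup-∷ʳ-inject₁ : ∀ {a} {A : Set a} (xs : Vec A n) (x : A) i → lookup (xs ∷ʳ x) (inject₁ i) ≡ lookup xs i
lookup-∷ʳ-inject₁ (_ ∷ _)  x zero    = refl
lookup-∷ʳ-inject₁ (_ ∷ xs) x (suc i) = lookup-∷ʳ-inject₁ xs x i

-- Membership in `PM n` phrased through entries alone, with no order relation to choose.
-- Antisymmetry of the order is contained in `triangular`, by antisymmetry of the integer order.
record IsPosetMatrix (A : Matrix n) : Set where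
  field
    diagonal   : ∀ i → entry A i i ≡ true
    transitive : ∀ i j k → entry A i j ≡ true → entry A j k ≡ true → entry A i k ≡ true
    triangular : ∀ i j → entry A i j ≡ true → j Fin.≤ i

open IsPosetMatrix

entry-posetMatrix : (P : NLPoset n) → let open NLPoset P using (_≼_) in
  ∀ i j → entry (posetMatrix P) i j ≡ true ⇔ j ≼ i
entry-posetMatrix P i j = subst (λ b → b ≡ true ⇔ j ≼ i) (sym eq) (does-true⇔ (j ≼? i))
  where
  open NLPoset P using (_≼_; _≼?_)
  eq : entry (posetMatrix P) i j ≡ does (j ≼? i)
  eq = trans (cong (λ row → lookup row j) (lookup∘tabulate _ i)) (lookup∘tabulate _ j)

posetMatrix-isPosetMatrix : (P : NLPoset n) → IsPosetMatrix (posetMatrix P)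
posetMatrix-isPosetMatrix P = record
  { diagonal   = λ i → from (entry-posetMatrix P i i) ≼.refl
  ; transitive = λ i j k ij jk → from (entry-posetMatrix P i k)
      (≼.trans (to (entry-posetMatrix P j k) jk) (to (entry-posetMatrix P i j) ij))
  ; triangular = λ i j ij → ≼.naturallyLabeled (to (entry-posetMatrix P i j) ij)
  }
  where module ≼ = NLPoset P

-- The order is read off the entries with arguments swapped, because row `y` marks the elements
-- below `y`. It is decidable because bits can be compared.
isPosetMatrix⇒PM : {A : Matrix n} → IsPosetMatrix A → PM n A
isPosetMatrix⇒PM {n} {A} pm = P , matrix≡
  where
  P : NLPoset n
  P = record
    { _≼_ = λ x y → entry A y x ≡ true
    ; isDecPartialOrder = record
      { isPartialOrder = record
        { isPreorder = record
          { isEquivalence = isEquivalence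
          ; reflexive     = λ { {x} refl → diagonal pm x }
          ; trans         = λ {x} {y} {z} xy yz → transitive pm z y x yz xy
          }
        ; antisym = λ {x} {y} xy yx → ≤-antisym (triangular pm y x xy) (triangular pm x y yx)
        }
      ; _≟_  = Fin._≟_
      ; _≤?_ = λ x y → entry A y x Bool.≟ true
      }
    ; naturallyLabeled = λ {x} {y} → triangular pm y x
    }

  matrix≡ : posetMatrix P ≡ A
  matrix≡ = trans
    (tabulate-cong λ i → trans (tabulate-cong λ j → does-≟true (entry A i j)) (tabulate∘lookup (lookup A i)))
    (tabulate∘lookup A)

PM⇔isPosetMatrix : {A : Matrix n} → PM n A ⇔ IsPosetMatrix A
PM⇔isPosetMatrix = mk⇔ (λ { (P , refl) → posetMatrix-isPosetMatrix P }) isPosetMatrix⇒PM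

-- The order ideal condition on the support of `v`, stated in bits: the common middle term of all
-- the equivalences below.
DownClosed : Matrix n → RowVector n → Set
DownClosed A v = ∀ i j → lookup v i ≡ true → entry A i j ≡ true → lookup v j ≡ true

module _ (A : Matrix n) (v : RowVector n) where

  lookup-·-true⇔ : ∀ j → lookup (v · A) j ≡ true ⇔ (∃[ i ] lookup v i ∧ entry A i j ≡ true)
  lookup-·-true⇔ j = subst (λ b → b ≡ true ⇔ (∃[ i ] lookup v i ∧ entry A i j ≡ true))
    (sym (lookup∘tabulate _ j)) (sum-true⇔ λ i → lookup v i ∧ entry A i j)

  fixed⇒downClosed : v · A ≡ v → DownClosed A v
  fixed⇒downClosed vA≡v i j vi ij = subst (λ u → lookup u j ≡ true) vA≡v
    -- The summand at `i` alone already makes entry `j` of `v · A` equal to 1.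
    (from (lookup-·-true⇔ j) (i , cong₂ _∧_ vi ij))

  downClosed⇒fixed : (∀ i → entry A i i ≡ true) → DownClosed A v → v · A ≡ v
  downClosed⇒fixed diag closed = trans (sym (tabulate∘lookup (v · A)))
    (trans (tabulate-cong λ j → ⇔→≡ (mk⇔ (shrink j) (grow j))) (tabulate∘lookup v))
    where
    shrink : ∀ j → lookup (v · A) j ≡ true → lookup v j ≡ true
    shrink j vAj = let i , eq = to (lookup-·-true⇔ j) vAj in
      closed i j (∧-conicalˡ _ _ eq) (∧-conicalʳ (lookup v i) _ eq)

    grow : ∀ j → lookup v j ≡ true → lookup (v · A) j ≡ true
    -- The witness is `j` itself, thanks to the 1 on the diagonal.
    grow j vj = from (lookup-·-true⇔ j) (j , cong₂ _∧_ vj (diag j))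

  row-^^-inject₁ : ∀ i → lookup (A ^^ v) (inject₁ i) ≡ lookup A i ∷ʳ false
  row-^^-inject₁ i = trans (lookup-∷ʳ-inject₁ (map (_∷ʳ false) A) _ i) (lookup-map i (_∷ʳ false) A)

  row-^^-fromℕ : lookup (A ^^ v) (fromℕ n) ≡ v ∷ʳ true
  row-^^-fromℕ = lookup-∷ʳ-fromℕ (map (_∷ʳ false) A) _

  entry-^^-inject₁-inject₁ : ∀ i j → entry (A ^^ v) (inject₁ i) (inject₁ j) ≡ entry A i j
  entry-^^-inject₁-inject₁ i j rewrite row-^^-inject₁ i = lookup-∷ʳ-inject₁ (lookup A i) false j

  entry-^^-inject₁-fromℕ : ∀ i → entry (A ^^ v) (inject₁ i) (fromℕ n) ≡ false
  entry-^^-inject₁-fromℕ i rewrite row-^^-inject₁ i = lookup-∷ʳ-fromℕ (lookup A i) false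

  entry-^^-fromℕ-inject₁ : ∀ j → entry (A ^^ v) (fromℕ n) (inject₁ j) ≡ lookup v j
  entry-^^-fromℕ-inject₁ j rewrite row-^^-fromℕ = lookup-∷ʳ-inject₁ v true j

  entry-^^-fromℕ-fromℕ : entry (A ^^ v) (fromℕ n) (fromℕ n) ≡ true
  entry-^^-fromℕ-fromℕ rewrite row-^^-fromℕ = lookup-∷ʳ-fromℕ v true

  -- Transitivity is applied to the chain from `j` through `i` up to the new element `fromℕ n`.
  ^^-isPosetMatrix⇒downClosed : IsPosetMatrix (A ^^ v) → DownClosed A v
  ^^-isPosetMatrix⇒downClosed pm i j vi ij = trans (sym (entry-^^-fromℕ-inject₁ j))
    (transitive pm (fromℕ n) (inject₁ i) (inject₁ j)
      (trans (entry-^^-fromℕ-inject₁ i) vi) (trans (entry-^^-inject₁-inject₁ i j) ij))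

  downClosed⇒^^-isPosetMatrix : IsPosetMatrix A → DownClosed A v → IsPosetMatrix (A ^^ v)
  downClosed⇒^^-isPosetMatrix pm closed = record
    { diagonal = diag ; transitive = transitivity ; triangular = triangle }
    where
    diag : ∀ i → entry (A ^^ v) i i ≡ true
    diag i with view i
    ... | ‵fromℕ     = entry-^^-fromℕ-fromℕ
    ... | ‵inject₁ i = trans (entry-^^-inject₁-inject₁ i i) (diagonal pm i)

    transitivity : ∀ i j k → entry (A ^^ v) i j ≡ true → entry (A ^^ v) j k ≡ true → entry (A ^^ v) i k ≡ true
    transitivity i j k ij jk with view i | view j | view k
    ... | ‵fromℕ     | ‵fromℕ     | _          = jk
    -- Above its last entry the new column is zero, so no old element lies above the new one; this
    -- rules out the present case and the next.
    ... | ‵inject₁ i | ‵fromℕ     | _          = contradiction (trans (sym ij) (entry-^^-inject₁-fromℕ i)) λ ()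
    ... | _          | ‵inject₁ j | ‵fromℕ     = contradiction (trans (sym jk) (entry-^^-inject₁-fromℕ j)) λ ()
    -- The one case where `closed` enters: the chain starts in the last row and continues inside
    -- `A`.
    ... | ‵fromℕ     | ‵inject₁ j | ‵inject₁ k = trans (entry-^^-fromℕ-inject₁ k)
      (closed j k (trans (sym (entry-^^-fromℕ-inject₁ j)) ij) (trans (sym (entry-^^-inject₁-inject₁ j k)) jk))
    ... | ‵inject₁ i | ‵inject₁ j | ‵inject₁ k = trans (entry-^^-inject₁-inject₁ i k)
      (transitive pm i j k (trans (sym (entry-^^-inject₁-inject₁ i j)) ij) (trans (sym (entry-^^-inject₁-inject₁ j k)) jk))

    triangle : ∀ i j → entry (A ^^ v) i j ≡ true → j Fin.≤ i
    triangle i j ij with view i | view j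
    ... | ‵fromℕ     | _          = ≤fromℕ j
    ... | ‵inject₁ i | ‵fromℕ     = contradiction (trans (sym ij) (entry-^^-inject₁-fromℕ i)) λ ()
    ... | ‵inject₁ i | ‵inject₁ j = subst₂ ℕ._≤_ (sym (toℕ-inject₁ j)) (sym (toℕ-inject₁ i))
      (triangular pm i j (trans (sym (entry-^^-inject₁-inject₁ i j)) ij))

  fixed⇔downClosed : IsPosetMatrix A → v · A ≡ v ⇔ DownClosed A v
  fixed⇔downClosed pm = mk⇔ fixed⇒downClosed (downClosed⇒fixed (diagonal pm))

  isPosetVector⇔downClosed : IsPosetMatrix A → IsPosetVector A v ⇔ DownClosed A v
  isPosetVector⇔downClosed pm =
    mk⇔ ^^-isPosetMatrix⇒downClosed (downClosed⇒^^-isPosetMatrix pm) ⇔-∘ PM⇔isPosetMatrix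

-- Subsets and row vectors are both vectors of bits, so a subset can serve as its own indicator
-- vector.
supp-id : (v : RowVector n) → supp v ≡ v
supp-id v = trans (tabulate-cong (does-≟true ∘ lookup v)) (tabulate∘lookup v)

orderIdeal⇔downClosed : (P : NLPoset n) (v : RowVector n) → OrderIdeals P v ⇔ DownClosed (posetMatrix P) v
orderIdeal⇔downClosed P v = mk⇔
  (λ ideal i j vi ij → []=⇒lookup (ideal (lookup⇒[]= i v vi) (to (entry-posetMatrix P i j) ij)))
  (λ closed {x} {y} y∈v x≼y → lookup⇒[]= x v
    (closed y x ([]=⇒lookup y∈v) (from (entry-posetMatrix P y x) x≼y)))

theorem5p3 : (n : ℕ) (A : Matrix n) (A∈PM : PM n A) →
    ((v : RowVector n) → IsPosetVector A v ⇔ (v · A ≡ v))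
    × (OrderIdeals (posetOf A∈PM) ≐ FixedSupports A)
-- Matching on `refl` turns `A` into `posetMatrix P`, so that `posetOf A∈PM` is `P` itself.
theorem5p3 n A A∈PM@(P , refl) =
  (λ v → ⇔-sym (fixed⇔downClosed A v pm) ⇔-∘ isPosetVector⇔downClosed A v pm) ,
  -- The fixed vector with support `S` is `S` itself.
  (λ {S} ideal → S , from (fixed⇔downClosed A S pm) (to (orderIdeal⇔downClosed P S) ideal) , supp-id S) ,
  (λ { (v , vA≡v , refl) → subst (λ u → OrderIdeals P u) (sym (supp-id v))
         (from (orderIdeal⇔downClosed P v) (to (fixed⇔downClosed A v pm) vA≡v)) })
  where
  pm : IsPosetMatrix A
  pm = to PM⇔isPosetMatrix A∈PM
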